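{- Let $n\ge1$. For any permutation $\sigma\in S_n$, $$\sum_{p\in\varphi^{ -1}(\sigma)} q^{\mathtt{area}(p)}=\prod_{i=1}^n [\ell(i;\sigma)]_q.$$
   Context: Write $[n]=\{1,\dots,n\}$. A street has parking spots $1,\dots,n$ in order, and cars $c_1,\dots,c_n$ arrive in this order. Given $\alpha=(a_1,\dots,a_n)\in[n]^n$, car $c_i$ drives to its preferred spot $a_i$ and parks there if it is empty; otherwise it continues forward and parks in the first empty spot after $a_i$, if there is one (otherwise it fails to park). The tuple $\alpha$ is a parking function of length $n$ if all $n$ cars park; $PF_n$ is the set of parking functions of length $n$. The map $\varphi:PF_n\to S_n$ sends $\alpha$ to the permutation $s_1s_2\cdots s_n$ (one-line notation), where spot $i$ is occupied by car $c_{s_i}$ after all cars have parked; $\varphi^{ -1}(\sigma)\subseteq PF_n$ is the fiber. For $\sigma=s_1\cdots s_n\in S_n$ and $1\le i\le n$, $\ell(i;\sigma)$ is the length of the longest subsequence $s_j\cdots s_i$ of consecutive entries of $\sigma$ such that $s_t\le s_i$ for all $j\le t\le i$. For a parking function $\alpha=(a_1,\dots,a_n)\in PF_n$, $\mathtt{area}(\alpha)=\sum_{i=1}^n (n-i-a_i+1)$. For a positive integer $m$, $[m]_q=1+q+q^2+\cdots+q^{m-1}$, where $q$ is an indeterminate. -}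

module Defs where

open import Data.Nat.Base as ℕ using (ℕ; zero; suc; _∸_; z≤n; s≤s)
import Data.Nat.Properties as ℕ
open import Data.Integer.Base as ℤ using (ℤ; +_; 0ℤ; 1ℤ; ∣_∣)
import Data.Integer.Properties as ℤ
open import Data.Fin.Base using (Fin; zero; suc; toℕ; _≤_; opposite; punchOut)
open import Data.Fin.Properties
  using (_≟_; _≤?_; all?; any?; toℕ<n; opposite-prop; punchOut-injective; injective⇒≤)
open import Data.Fin.Permutation as Perm
  using (Permutation′; permutation; _⟨$⟩ʳ_; flip)
open import Data.List.Base as List
  using (List; []; _∷_; foldr; upTo; allFin; filter; mapMaybe; cartesianProductWith)
open import Data.List.Extrema.Nat using (max)
open import Data.List.Membership.Propositional using (_∈_)
open import Data.List.Membership.Propositional.Properties using (∈-allFin)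
open import Data.List.Relation.Unary.Any using (here; there)
open import Data.Maybe.Base as Maybe using (Maybe; just; nothing; _>>=_)
open import Data.Maybe using (Is-just; to-witness)
import Data.Maybe.Properties as Maybe
import Data.Maybe.Relation.Unary.Any as MaybeAny
open import Data.Product.Base using (Σ; ∃; _×_; _,_; proj₁; proj₂)
open import Data.Unit.Base using (tt)
open import Data.Vec.Base using (Vec; []; _∷_; lookup; replicate)
open import Function.Definitions using (Injective)
open import Relation.Binary.PropositionalEquality
  using (_≡_; refl; sym; trans; cong; cong₂; subst; module ≡-Reasoning)
open import Relation.Nullary.Decidable
  using (Dec; yes; no; _×-dec_; _→-dec_; dec⇒maybe)
open import Relation.Nullary.Negation using (¬_; contradiction)
open import Algebra.Properties.CommutativeMonoid.Sum ℤ.+-0-commutativeMonoid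
  using (sum; sum-syntax; sum-cong-≗; ∑-distrib-+; sum-permute)

-- Spots, cars and preferences are all elements of Fin n: the element i
-- stands for the number suc (toℕ i) of {1, …, n}.

Tuple : ℕ → Set
Tuple n = Vec (Fin n) n

Street : Set → ℕ → Set
Street Car m = Vec (Maybe Car) m

module _ {Car : Set} where

  parkInFirstEmpty : ∀ {m} → Car → Street Car m → Maybe (Street Car m)
  parkInFirstEmpty c []            = nothing
  parkInFirstEmpty c (nothing ∷ s) = just (just c ∷ s)
  parkInFirstEmpty c (just d  ∷ s) = Maybe.map (just d ∷_) (parkInFirstEmpty c s)

  -- A car preferring spot a takes the first empty spot among a, a + 1, …;
  -- the result is nothing when it fails to park.

  park : ∀ {m} → Fin m → Car → Street Car m → Maybe (Street Car m)
  park zero    c s       = parkInFirstEmpty c s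
  park (suc a) c (x ∷ s) = Maybe.map (x ∷_) (park a c s)

-- Parks the listed cars in order; nothing as soon as one of them fails.

parkCars : ∀ {n} → Tuple n → List (Fin n) → Street (Fin n) n → Maybe (Street (Fin n) n)
parkCars α []       s = just s
parkCars α (c ∷ cs) s = park (lookup α c) c s >>= parkCars α cs

outcome : ∀ {n} → Tuple n → Maybe (Street (Fin n) n)
outcome {n} α = parkCars α (allFin n) (replicate n nothing)

IsParkingFunction : ∀ {n} → Tuple n → Set
IsParkingFunction α = Is-just (outcome α)

isParkingFunction? : ∀ {n} (α : Tuple n) → Dec (IsParkingFunction α)
isParkingFunction? α = MaybeAny.dec (λ _ → yes tt) (outcome α)

PF : ℕ → Set
PF n = Σ (Tuple n) IsParkingFunction

finalStreet : ∀ {n} → PF n → Street (Fin n) n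
finalStreet (α , parks) = to-witness parks

map-just⁻ : ∀ {A B : Set} (f : A → B) (x : Maybe A) {y} →
            Maybe.map f x ≡ just y → ∃ λ z → x ≡ just z × f z ≡ y
map-just⁻ f (just z) refl = z , refl , refl

>>=-just⁻ : ∀ {A B : Set} (x : Maybe A) (f : A → Maybe B) {y} →
            (x >>= f) ≡ just y → ∃ λ z → x ≡ just z × f z ≡ just y
>>=-just⁻ (just z) f eq = z , refl , eq

record Parked {Car : Set} {m} (Ok : Fin m → Set) (c : Car) (s s′ : Street Car m) : Set where
  constructor parked
  field
    spot   : Fin m
    ok     : Ok spot
    inSpot : lookup s′ spot ≡ just c
    keeps  : ∀ j {d} → lookup s j ≡ just d → lookup s′ j ≡ just d

module _ {Car : Set} where

  parked-∷ : ∀ {m} {Ok : Fin m → Set} {Ok′ : Fin (suc m) → Set}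
               {c : Car} {x} {s s′ : Street Car m} →
             (∀ {i} → Ok i → Ok′ (suc i)) →
             Parked Ok c s s′ → Parked Ok′ c (x ∷ s) (x ∷ s′)
  parked-∷ f (parked k o t p) = parked (suc k) (f o) t λ where
    zero    eq → eq
    (suc j) eq → p j eq

  parkInFirstEmpty-parked : ∀ {m} (c : Car) (s : Street Car m) {s′} →
    parkInFirstEmpty c s ≡ just s′ → Parked (λ i → 0 ℕ.≤ toℕ i) c s s′
  parkInFirstEmpty-parked c (nothing ∷ s) refl = parked zero z≤n refl λ where
    (suc j) eq → eq
  parkInFirstEmpty-parked c (just d ∷ s) eq
    with map-just⁻ (just d ∷_) (parkInFirstEmpty c s) eq
  ... | s″ , eq′ , refl = parked-∷ (λ _ → z≤n) (parkInFirstEmpty-parked c s eq′)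

  park-parked : ∀ {m} (a : Fin m) (c : Car) (s : Street Car m) {s′} →
    park a c s ≡ just s′ → Parked (a ≤_) c s s′
  park-parked zero    c s       eq = parkInFirstEmpty-parked c s eq
  park-parked (suc a) c (x ∷ s) eq with map-just⁻ (x ∷_) (park a c s) eq
  ... | s″ , eq′ , refl = parked-∷ s≤s (park-parked a c s eq′)

parkCars-keeps : ∀ {n} (α : Tuple n) cs s {s′} → parkCars α cs s ≡ just s′ →
  ∀ j {d} → lookup s j ≡ just d → lookup s′ j ≡ just d
parkCars-keeps α []       s refl j eq = eq
parkCars-keeps α (c ∷ cs) s eq   j e
  with >>=-just⁻ (park (lookup α c) c s) (parkCars α cs) eq
... | s₁ , eq₁ , eq₂ =
  parkCars-keeps α cs s₁ eq₂ j (Parked.keeps (park-parked (lookup α c) c s eq₁) j e)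

parkCars-parks : ∀ {n} (α : Tuple n) cs s {s′} → parkCars α cs s ≡ just s′ →
  ∀ {c} → c ∈ cs → ∃ λ k → lookup α c ≤ k × lookup s′ k ≡ just c
parkCars-parks α (c ∷ cs) s eq c∈
  with >>=-just⁻ (park (lookup α c) c s) (parkCars α cs) eq
parkCars-parks α (c ∷ cs) s eq (here refl) | s₁ , eq₁ , eq₂ =
  let parked k a≤k t _ = park-parked (lookup α c) c s eq₁
  in  k , a≤k , parkCars-keeps α cs s₁ eq₂ k t
parkCars-parks α (c ∷ cs) s eq (there c∈) | s₁ , eq₁ , eq₂ =
  parkCars-parks α cs s₁ eq₂ c∈

to-witness-just : ∀ {A : Set} {x : Maybe A} (p : Is-just x) → x ≡ just (to-witness p)
to-witness-just (MaybeAny.just _) = refl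

injective⇒surjective : ∀ {n} (f : Fin n → Fin n) → Injective _≡_ _≡_ f →
                       ∀ j → ∃ λ i → f i ≡ j
injective⇒surjective {suc n} f inj j with any? (λ i → f i ≟ j)
... | yes found = found
... | no ¬found = contradiction
  (injective⇒≤ {f = λ i → punchOut (miss i)}
    (λ {i} {k} eq → inj (punchOut-injective (miss i) (miss k) eq)))
  (ℕ.<⇒≱ (ℕ.n<1+n n))
  where
  miss : ∀ i → ¬ (j ≡ f i)
  miss i eq = ¬found (i , sym eq)

parkedAt : ∀ {n} (p : PF n) (c : Fin n) →
           ∃ λ k → lookup (proj₁ p) c ≤ k × lookup (finalStreet p) k ≡ just c
parkedAt {n} (α , parks) c =
  parkCars-parks α (allFin n) (replicate n nothing) (to-witness-just parks) (∈-allFin c)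

module _ {n} (p : PF n) where

  spotOf : Fin n → Fin n
  spotOf c = proj₁ (parkedAt p c)

  preference≤spotOf : ∀ c → lookup (proj₁ p) c ≤ spotOf c
  preference≤spotOf c = proj₁ (proj₂ (parkedAt p c))

  lookup-spotOf : ∀ c → lookup (finalStreet p) (spotOf c) ≡ just c
  lookup-spotOf c = proj₂ (proj₂ (parkedAt p c))

  spotOf-injective : Injective _≡_ _≡_ spotOf
  spotOf-injective {c} {d} eq = Maybe.just-injective
    (trans (sym (lookup-spotOf c))
      (trans (cong (lookup (finalStreet p)) eq) (lookup-spotOf d)))

  carIn : Fin n → Fin n
  carIn k = proj₁ (injective⇒surjective spotOf spotOf-injective k)

  spotOf-carIn : ∀ k → spotOf (carIn k) ≡ k
  spotOf-carIn k = proj₂ (injective⇒surjective spotOf spotOf-injective k)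

  carIn-spotOf : ∀ c → carIn (spotOf c) ≡ c
  carIn-spotOf c = spotOf-injective (spotOf-carIn (spotOf c))

-- A permutation σ has one-line notation (σ ⟨$⟩ʳ 0) (σ ⟨$⟩ʳ 1) ⋯ .

φ : ∀ {n} → PF n → Permutation′ n
φ p = permutation (carIn p) (spotOf p) (carIn-spotOf p) (spotOf-carIn p)

finalStreet-φ : ∀ {n} (p : PF n) k → lookup (finalStreet p) k ≡ just (φ p ⟨$⟩ʳ k)
finalStreet-φ p k =
  trans (cong (lookup (finalStreet p)) (sym (spotOf-carIn p k))) (lookup-spotOf p (carIn p k))

-- Enumerates every vector exactly once, so that parkingFunctions and fiber
-- below are repetition-free lists of the elements of PFₙ and φ⁻¹(σ).

vectors : ∀ n k → List (Vec (Fin n) k)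
vectors n zero    = [] ∷ []
vectors n (suc k) = cartesianProductWith _∷_ (allFin n) (vectors n k)

parkingFunctions : ∀ n → List (PF n)
parkingFunctions n =
  mapMaybe (λ α → Maybe.map (α ,_) (dec⇒maybe (isParkingFunction? α))) (vectors n n)

_≈?_ : ∀ {n} (π ρ : Permutation′ n) → Dec (π Perm.≈ ρ)
π ≈? ρ = all? λ i → (π ⟨$⟩ʳ i) ≟ (ρ ⟨$⟩ʳ i)

fiber : ∀ {n} → Permutation′ n → List (PF n)
fiber {n} σ = filter (λ p → φ p ≈? σ) (parkingFunctions n)

IsBlock : ∀ {n} → Permutation′ n → (i j : Fin n) → Set
IsBlock σ i j = j ≤ i × (∀ t → j ≤ t → t ≤ i → (σ ⟨$⟩ʳ t) ≤ (σ ⟨$⟩ʳ i))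

isBlock? : ∀ {n} (σ : Permutation′ n) (i j : Fin n) → Dec (IsBlock σ i j)
isBlock? σ i j =
  (j ≤? i) ×-dec
  all? (λ t → (j ≤? t) →-dec ((t ≤? i) →-dec ((σ ⟨$⟩ʳ t) ≤? (σ ⟨$⟩ʳ i))))

-- The default value 0 of max is never attained, since j = i qualifies.

ℓ : ∀ {n} → Fin n → Permutation′ n → ℕ
ℓ {n} i σ =
  max 0 (List.map (λ j → suc (toℕ i) ∸ toℕ j) (filter (isBlock? σ i) (allFin n)))

areaℤ : ∀ {n} → Tuple n → ℤ
areaℤ {n} α =
  ∑[ i < n ] (+ n ℤ.- + suc (toℕ i) ℤ.- + suc (toℕ (lookup α i)) ℤ.+ 1ℤ)

-- Single terms of the sum may be negative, but for a parking function the
-- total is not (area-areaℤ), so taking the absolute value loses nothing.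

area : ∀ {n} → PF n → ℕ
area (α , _) = ∣ areaℤ α ∣

n-i-1 : ∀ {n} (i : Fin n) → + n ℤ.- + suc (toℕ i) ≡ + toℕ (opposite i)
n-i-1 {n} i = begin
  + n ℤ.- + suc (toℕ i)  ≡⟨ ℤ.m-n≡m⊖n n (suc (toℕ i)) ⟩
  n ℤ.⊖ suc (toℕ i)      ≡⟨ ℤ.⊖-≥ (toℕ<n i) ⟩
  + (n ∸ suc (toℕ i))    ≡⟨ cong +_ (opposite-prop i) ⟨
  + toℕ (opposite i)     ∎
  where open ≡-Reasoning

-[1+a]+1 : ∀ x a → x ℤ.- + suc a ℤ.+ 1ℤ ≡ x ℤ.+ ℤ.- (+ a)
-[1+a]+1 x a = trans (ℤ.+-assoc x (ℤ.- + suc a) 1ℤ) (cong (λ y → x ℤ.+ y) (lemma a))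
  where
  lemma : ∀ a → ℤ.- + suc a ℤ.+ 1ℤ ≡ ℤ.- (+ a)
  lemma zero    = refl
  lemma (suc a) = refl

sum-nonNeg : ∀ {n} (f : Fin n → ℤ) → (∀ i → 0ℤ ℤ.≤ f i) → 0ℤ ℤ.≤ sum f
sum-nonNeg {zero}  f f≥0 = ℤ.≤-refl
sum-nonNeg {suc n} f f≥0 =
  ℤ.+-mono-≤ (f≥0 zero) (sum-nonNeg (λ i → f (suc i)) (λ i → f≥0 (suc i)))

areaℤ-displacement : ∀ {n} (p : PF n) →
  areaℤ (proj₁ p) ≡ ∑[ i < n ] (+ toℕ (spotOf p i) ℤ.- + toℕ (lookup (proj₁ p) i))
areaℤ-displacement {n} p@(α , _) = begin
  areaℤ α
    ≡⟨ sum-cong-≗ {n} (λ i → trans (-[1+a]+1 (+ n ℤ.- + suc (toℕ i)) (toℕ (lookup α i))) (cong (ℤ._+ -a i) (n-i-1 i))) ⟩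
  ∑[ i < n ] (+ toℕ (opposite i) ℤ.+ -a i)
    ≡⟨ ∑-distrib-+ {n} (λ i → + toℕ (opposite i)) -a ⟩
  ∑[ i < n ] (+ toℕ (opposite i)) ℤ.+ sum -a
    ≡⟨ cong (ℤ._+ sum -a) (sum-permute {n} (λ i → + toℕ i) Perm.reverse) ⟨
  ∑[ i < n ] (+ toℕ i) ℤ.+ sum -a
    ≡⟨ cong (ℤ._+ sum -a) (sum-permute {n} (λ i → + toℕ i) (flip (φ p))) ⟩
  ∑[ i < n ] (+ toℕ (spotOf p i)) ℤ.+ sum -a
    ≡⟨ ∑-distrib-+ {n} (λ i → + toℕ (spotOf p i)) -a ⟨
  ∑[ i < n ] (+ toℕ (spotOf p i) ℤ.+ -a i) ∎
  where
  open ≡-Reasoning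
  -a : Fin n → ℤ
  -a i = ℤ.- (+ toℕ (lookup α i))

area-areaℤ : ∀ {n} (p : PF n) → + area p ≡ areaℤ (proj₁ p)
area-areaℤ p = ℤ.0≤i⇒+∣i∣≡i
  (subst (0ℤ ℤ.≤_) (sym (areaℤ-displacement p))
    (sum-nonNeg _ (λ i → ℤ.i≤j⇒0≤j-i (ℤ.+≤+ (preference≤spotOf p i)))))

-- A polynomial in ℤ[q] is its list of coefficients, constant term first; lists
-- differing by trailing zeros are identified by _≈ₚ_.

Poly : Set
Poly = List ℤ

coeff : Poly → ℕ → ℤ
coeff []      _       = 0ℤ
coeff (a ∷ f) zero    = a
coeff (a ∷ f) (suc k) = coeff f k

infix  4 _≈ₚ_
infixl 6 _+ₚ_
infixl 7 _*ₚ_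
infixr 8 _^ₚ_

_≈ₚ_ : Poly → Poly → Set
f ≈ₚ g = ∀ k → coeff f k ≡ coeff g k

0ₚ 1ₚ q : Poly
0ₚ = []
1ₚ = 1ℤ ∷ []
q  = 0ℤ ∷ 1ℤ ∷ []

_+ₚ_ : Poly → Poly → Poly
[]      +ₚ g       = g
(a ∷ f) +ₚ []      = a ∷ f
(a ∷ f) +ₚ (b ∷ g) = (a ℤ.+ b) ∷ (f +ₚ g)

_*ₚ_ : Poly → Poly → Poly
[]      *ₚ g = 0ₚ
(a ∷ f) *ₚ g = List.map (a ℤ.*_) g +ₚ (0ℤ ∷ (f *ₚ g))

_^ₚ_ : Poly → ℕ → Poly
f ^ₚ zero  = 1ₚ
f ^ₚ suc k = f *ₚ (f ^ₚ k)

sumₚ productₚ : List Poly → Poly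
sumₚ     = foldr _+ₚ_ 0ₚ
productₚ = foldr _*ₚ_ 1ₚ

[_]q : ℕ → Poly
[ m ]q = sumₚ (List.map (q ^ₚ_) (upTo m))

{-
A tuple α lies in the fiber over σ exactly when every car c finds, on its arrival,
all spots from its preference up to its spot k = σ⁻¹(c) (excluded) occupied. Those
spots are then held by cars arriving before c, so the condition says that the
entries of σ from position α(c) to k are all at most σ(k) = c: a condition on each
preference separately, with k − α(c) ranging over 0, …, ℓ(k; σ) − 1. As the area is
the total displacement Σ (k − α(c)), the generating function factors over the cars,
and permuting the factors by σ turns it into the product over the spots.
-}

module Submission where

open import Defs
open import Algebra.Bundles using (CommutativeMonoid; CommutativeSemiring)
import Algebra.Properties.CommutativeMonoid.Sum as MonoidSum
import Algebra.Properties.Semiring.Sum as SemiringSum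
open import Algebra.Structures using (IsCommutativeMonoid)
open import Algebra.Structures.Biased using (isCommutativeSemiringˡ)
open import Data.Bool.Base using (true; false; if_then_else_)
open import Data.Fin.Base as Fin using (Fin; zero; suc; toℕ)
open import Data.Fin.Permutation as Perm
  using (Permutation′; _⟨$⟩ʳ_; _⟨$⟩ˡ_; inverseˡ; inverseʳ; flip)
open import Data.Fin.Properties using (_≟_; toℕ<n; ≤-antisym; ≤∧≢⇒<; ¬∀⟶∃¬)
open import Data.Integer.Base as ℤ using (+_; 0ℤ; 1ℤ)
import Data.Integer.Properties as ℤ
open import Data.List.Base
  using (List; []; _∷_; _++_; map; foldr; tabulate; allFin; upTo; filter; mapMaybe;
         cartesianProductWith)
open import Data.List.Extrema.Nat using (argmax-sel; xs≤max)
open import Data.List.Membership.Propositional.Properties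
  using (∈-map⁺; ∈-map⁻; ∈-filter⁺; ∈-filter⁻; ∈-allFin)
open import Data.List.Properties using (map-tabulate; upTo-∷ʳ)
import Data.List.Relation.Unary.All as All
open import Data.Maybe using (Is-just)
open import Data.Maybe.Base as Maybe using (Maybe; just; nothing; maybe′; _>>=_)
open import Data.Maybe.Properties using (just-injective)
import Data.Maybe.Relation.Unary.Any as MaybeAny
open import Data.Nat.Base as ℕ using (ℕ; zero; suc; _∸_; _≤_; z≤n; s≤s)
import Data.Nat.Properties as ℕ
open import Data.Product.Base using (∃; _×_; _,_; proj₁; proj₂)
open import Data.Sum.Base using (inj₁; inj₂)
open import Data.Unit.Base using (tt)
open import Data.Vec.Base using ([]; _∷_; lookup; replicate; _[_]≔_)
open import Data.Vec.Properties using (lookup∘updateAt; lookup∘updateAt′; lookup-replicate)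
open import Function.Base using (_∘_; id)
open import Level using (0ℓ)
open import Relation.Binary.PropositionalEquality
  using (_≡_; refl; sym; trans; cong; cong₂; subst; module ≡-Reasoning)
open import Relation.Binary.Structures using (IsEquivalence)
open import Relation.Nullary.Decidable using (Dec; does; yes; no; dec⇒maybe)
open import Relation.Nullary.Negation using (¬_; contradiction)
open import Relation.Unary using (Decidable)

open import Algebra.Properties.CommutativeSemigroup ℤ.+-commutativeSemigroup
  using (x∙yz≈y∙xz; interchange)

-- The semiring of polynomials

≈ₚ-isEquivalence : IsEquivalence _≈ₚ_
≈ₚ-isEquivalence = record
  { refl  = λ k → refl
  ; sym   = λ f≈g k → sym (f≈g k)
  ; trans = λ f≈g g≈h k → trans (f≈g k) (g≈h k)
  }

∷-cong : ∀ a {f g} → f ≈ₚ g → (a ∷ f) ≈ₚ (a ∷ g)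
∷-cong a f≈g zero    = refl
∷-cong a f≈g (suc k) = f≈g k

0∷[]≈[] : (0ℤ ∷ []) ≈ₚ []
0∷[]≈[] zero    = refl
0∷[]≈[] (suc k) = refl

-- Coefficients do not see trailing zeros, so through this formula the laws of `_+ₚ_` reduce to
-- those of integer addition.
coeff-+ₚ : ∀ f g k → coeff (f +ₚ g) k ≡ coeff f k ℤ.+ coeff g k
coeff-+ₚ []      g       k       = sym (ℤ.+-identityˡ _)
coeff-+ₚ (a ∷ f) []      k       = sym (ℤ.+-identityʳ _)
coeff-+ₚ (a ∷ f) (b ∷ g) zero    = refl
coeff-+ₚ (a ∷ f) (b ∷ g) (suc k) = coeff-+ₚ f g k

coeff-map-* : ∀ a f k → coeff (map (a ℤ.*_) f) k ≡ a ℤ.* coeff f k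
coeff-map-* a []      k       = sym (ℤ.*-zeroʳ a)
coeff-map-* a (b ∷ f) zero    = refl
coeff-map-* a (b ∷ f) (suc k) = coeff-map-* a f k

coeff-∷-* : ∀ a f g k → coeff ((a ∷ f) *ₚ g) k ≡ a ℤ.* coeff g k ℤ.+ coeff (0ℤ ∷ f *ₚ g) k
coeff-∷-* a f g k =
  trans (coeff-+ₚ (map (a ℤ.*_) g) _ k) (cong (ℤ._+ coeff (0ℤ ∷ f *ₚ g) k) (coeff-map-* a g k))

-- `_*ₚ_` recurses on its left factor; this mirror recursion on the right factor is what makes
-- commutativity an induction.
coeff-*-∷ : ∀ f b g k → coeff (f *ₚ (b ∷ g)) k ≡ b ℤ.* coeff f k ℤ.+ coeff (0ℤ ∷ f *ₚ g) k
coeff-*-∷ []      b g k       = sym (cong₂ ℤ._+_ (ℤ.*-zeroʳ b) (0∷[]≈[] k))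
coeff-*-∷ (a ∷ f) b g zero    = cong (ℤ._+ 0ℤ) (ℤ.*-comm a b)
coeff-*-∷ (a ∷ f) b g (suc k) = begin
  coeff ((a ∷ f) *ₚ (b ∷ g)) (suc k)
    ≡⟨ coeff-∷-* a f (b ∷ g) (suc k) ⟩
  a ℤ.* coeff g k ℤ.+ coeff (f *ₚ (b ∷ g)) k
    ≡⟨ cong (ℤ._+_ (a ℤ.* coeff g k)) (coeff-*-∷ f b g k) ⟩
  a ℤ.* coeff g k ℤ.+ (b ℤ.* coeff f k ℤ.+ coeff (0ℤ ∷ f *ₚ g) k)
    ≡⟨ x∙yz≈y∙xz (a ℤ.* coeff g k) (b ℤ.* coeff f k) _ ⟩
  b ℤ.* coeff f k ℤ.+ (a ℤ.* coeff g k ℤ.+ coeff (0ℤ ∷ f *ₚ g) k)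
    ≡⟨ cong (ℤ._+_ (b ℤ.* coeff f k)) (coeff-∷-* a f g k) ⟨
  b ℤ.* coeff f k ℤ.+ coeff ((a ∷ f) *ₚ g) k ∎
  where open ≡-Reasoning

+ₚ-cong : ∀ {f f′ g g′} → f ≈ₚ f′ → g ≈ₚ g′ → (f +ₚ g) ≈ₚ (f′ +ₚ g′)
+ₚ-cong {f} {f′} {g} {g′} f≈f′ g≈g′ k =
  trans (coeff-+ₚ f g k) (trans (cong₂ ℤ._+_ (f≈f′ k) (g≈g′ k)) (sym (coeff-+ₚ f′ g′ k)))

+ₚ-assoc : ∀ f g h → (f +ₚ g +ₚ h) ≈ₚ (f +ₚ (g +ₚ h))
+ₚ-assoc f g h k = begin
  coeff (f +ₚ g +ₚ h) k                          ≡⟨ coeff-+ₚ (f +ₚ g) h k ⟩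
  coeff (f +ₚ g) k ℤ.+ coeff h k                 ≡⟨ cong (ℤ._+ coeff h k) (coeff-+ₚ f g k) ⟩
  coeff f k ℤ.+ coeff g k ℤ.+ coeff h k          ≡⟨ ℤ.+-assoc (coeff f k) _ _ ⟩
  coeff f k ℤ.+ (coeff g k ℤ.+ coeff h k)        ≡⟨ cong (ℤ._+_ (coeff f k)) (coeff-+ₚ g h k) ⟨
  coeff f k ℤ.+ coeff (g +ₚ h) k                 ≡⟨ coeff-+ₚ f (g +ₚ h) k ⟨
  coeff (f +ₚ (g +ₚ h)) k                        ∎
  where open ≡-Reasoning

+ₚ-comm : ∀ f g → (f +ₚ g) ≈ₚ (g +ₚ f)
+ₚ-comm f g k =
  trans (coeff-+ₚ f g k) (trans (ℤ.+-comm (coeff f k) (coeff g k)) (sym (coeff-+ₚ g f k)))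

*ₚ-zeroʳ : ∀ f → (f *ₚ 0ₚ) ≈ₚ 0ₚ
*ₚ-zeroʳ []      k = refl
*ₚ-zeroʳ (a ∷ f) k = trans (∷-cong 0ℤ (*ₚ-zeroʳ f) k) (0∷[]≈[] k)

*ₚ-congˡ : ∀ f {g g′} → g ≈ₚ g′ → (f *ₚ g) ≈ₚ (f *ₚ g′)
*ₚ-congˡ []      g≈g′ k = refl
*ₚ-congˡ (a ∷ f) {g} {g′} g≈g′ k = begin
  coeff ((a ∷ f) *ₚ g) k                          ≡⟨ coeff-∷-* a f g k ⟩
  a ℤ.* coeff g k ℤ.+ coeff (0ℤ ∷ f *ₚ g) k       ≡⟨ cong₂ (λ x y → a ℤ.* x ℤ.+ y)
                                                       (g≈g′ k) (∷-cong 0ℤ (*ₚ-congˡ f g≈g′) k) ⟩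
  a ℤ.* coeff g′ k ℤ.+ coeff (0ℤ ∷ f *ₚ g′) k     ≡⟨ coeff-∷-* a f g′ k ⟨
  coeff ((a ∷ f) *ₚ g′) k                         ∎
  where open ≡-Reasoning

*ₚ-comm : ∀ f g → (f *ₚ g) ≈ₚ (g *ₚ f)
*ₚ-comm []      g k = sym (*ₚ-zeroʳ g k)
*ₚ-comm (a ∷ f) g k = begin
  coeff ((a ∷ f) *ₚ g) k                      ≡⟨ coeff-∷-* a f g k ⟩
  a ℤ.* coeff g k ℤ.+ coeff (0ℤ ∷ f *ₚ g) k   ≡⟨ cong (ℤ._+_ (a ℤ.* coeff g k)) (∷-cong 0ℤ (*ₚ-comm f g) k) ⟩
  a ℤ.* coeff g k ℤ.+ coeff (0ℤ ∷ g *ₚ f) k   ≡⟨ coeff-*-∷ g a f k ⟨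
  coeff (g *ₚ (a ∷ f)) k                      ∎
  where open ≡-Reasoning

-- Lists related by `_≈ₚ_` may differ in length, so instead of a recursion on the left factors
-- commutativity moves the change to the right.
*ₚ-congʳ : ∀ {f f′} g → f ≈ₚ f′ → (f *ₚ g) ≈ₚ (f′ *ₚ g)
*ₚ-congʳ {f} {f′} g f≈f′ k =
  trans (*ₚ-comm f g k) (trans (*ₚ-congˡ g f≈f′ k) (*ₚ-comm g f′ k))

*ₚ-distribˡ : ∀ f g h → (f *ₚ (g +ₚ h)) ≈ₚ (f *ₚ g +ₚ f *ₚ h)
*ₚ-distribˡ []      g h k = refl
*ₚ-distribˡ (a ∷ f) g h k = begin
  coeff ((a ∷ f) *ₚ (g +ₚ h)) k
    ≡⟨ coeff-∷-* a f (g +ₚ h) k ⟩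
  a ℤ.* coeff (g +ₚ h) k ℤ.+ coeff (0ℤ ∷ f *ₚ (g +ₚ h)) k
    ≡⟨ cong₂ ℤ._+_
         (trans (cong (a ℤ.*_) (coeff-+ₚ g h k)) (ℤ.*-distribˡ-+ a (coeff g k) (coeff h k)))
         (trans (∷-cong 0ℤ (*ₚ-distribˡ f g h) k) (coeff-+ₚ (0ℤ ∷ f *ₚ g) (0ℤ ∷ f *ₚ h) k)) ⟩
  (a ℤ.* coeff g k ℤ.+ a ℤ.* coeff h k) ℤ.+ (coeff (0ℤ ∷ f *ₚ g) k ℤ.+ coeff (0ℤ ∷ f *ₚ h) k)
    ≡⟨ interchange (a ℤ.* coeff g k) (a ℤ.* coeff h k) _ _ ⟩
  (a ℤ.* coeff g k ℤ.+ coeff (0ℤ ∷ f *ₚ g) k) ℤ.+ (a ℤ.* coeff h k ℤ.+ coeff (0ℤ ∷ f *ₚ h) k)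
    ≡⟨ cong₂ ℤ._+_ (coeff-∷-* a f g k) (coeff-∷-* a f h k) ⟨
  coeff ((a ∷ f) *ₚ g) k ℤ.+ coeff ((a ∷ f) *ₚ h) k
    ≡⟨ coeff-+ₚ ((a ∷ f) *ₚ g) ((a ∷ f) *ₚ h) k ⟨
  coeff ((a ∷ f) *ₚ g +ₚ (a ∷ f) *ₚ h) k ∎
  where open ≡-Reasoning

*ₚ-distribʳ : ∀ h f g → ((f +ₚ g) *ₚ h) ≈ₚ (f *ₚ h +ₚ g *ₚ h)
*ₚ-distribʳ h f g k = trans (*ₚ-comm (f +ₚ g) h k)
  (trans (*ₚ-distribˡ h f g k)
    (+ₚ-cong {h *ₚ f} {f *ₚ h} {h *ₚ g} {g *ₚ h} (*ₚ-comm h f) (*ₚ-comm h g) k))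

0∷-*ₚ : ∀ f g → ((0ℤ ∷ f) *ₚ g) ≈ₚ (0ℤ ∷ f *ₚ g)
0∷-*ₚ f g k = trans (coeff-∷-* 0ℤ f g k) (ℤ.+-identityˡ _)

-- In `(a ∷ f) *ₚ g *ₚ h` the head `a` contributes the left factor `map (a ℤ.*_) g`; associativity
-- requires pulling the scalar out of its product with `h`.
coeff-map-*-*ₚ : ∀ a f g k → coeff (map (a ℤ.*_) f *ₚ g) k ≡ a ℤ.* coeff (f *ₚ g) k
coeff-map-*-*ₚ a []      g k = sym (ℤ.*-zeroʳ a)
coeff-map-*-*ₚ a (b ∷ f) g k = begin
  coeff ((a ℤ.* b ∷ map (a ℤ.*_) f) *ₚ g) k
    ≡⟨ coeff-∷-* (a ℤ.* b) (map (a ℤ.*_) f) g k ⟩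
  a ℤ.* b ℤ.* coeff g k ℤ.+ coeff (0ℤ ∷ map (a ℤ.*_) f *ₚ g) k
    ≡⟨ cong₂ ℤ._+_ (ℤ.*-assoc a b (coeff g k)) (shifted k) ⟩
  a ℤ.* (b ℤ.* coeff g k) ℤ.+ a ℤ.* coeff (0ℤ ∷ f *ₚ g) k
    ≡⟨ ℤ.*-distribˡ-+ a (b ℤ.* coeff g k) _ ⟨
  a ℤ.* (b ℤ.* coeff g k ℤ.+ coeff (0ℤ ∷ f *ₚ g) k)
    ≡⟨ cong (a ℤ.*_) (coeff-∷-* b f g k) ⟨
  a ℤ.* coeff ((b ∷ f) *ₚ g) k ∎
  where
  open ≡-Reasoning
  shifted : ∀ k → coeff (0ℤ ∷ map (a ℤ.*_) f *ₚ g) k ≡ a ℤ.* coeff (0ℤ ∷ f *ₚ g) k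
  shifted zero    = sym (ℤ.*-zeroʳ a)
  shifted (suc k) = coeff-map-*-*ₚ a f g k

*ₚ-assoc : ∀ f g h → (f *ₚ g *ₚ h) ≈ₚ (f *ₚ (g *ₚ h))
*ₚ-assoc []      g h k = refl
*ₚ-assoc (a ∷ f) g h k = begin
  coeff ((map (a ℤ.*_) g +ₚ (0ℤ ∷ f *ₚ g)) *ₚ h) k
    ≡⟨ *ₚ-distribʳ h (map (a ℤ.*_) g) (0ℤ ∷ f *ₚ g) k ⟩
  coeff (map (a ℤ.*_) g *ₚ h +ₚ (0ℤ ∷ f *ₚ g) *ₚ h) k
    ≡⟨ coeff-+ₚ (map (a ℤ.*_) g *ₚ h) _ k ⟩
  coeff (map (a ℤ.*_) g *ₚ h) k ℤ.+ coeff ((0ℤ ∷ f *ₚ g) *ₚ h) k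
    ≡⟨ cong₂ ℤ._+_ (coeff-map-*-*ₚ a g h k)
         (trans (0∷-*ₚ (f *ₚ g) h k) (∷-cong 0ℤ (*ₚ-assoc f g h) k)) ⟩
  a ℤ.* coeff (g *ₚ h) k ℤ.+ coeff (0ℤ ∷ f *ₚ (g *ₚ h)) k
    ≡⟨ coeff-∷-* a f (g *ₚ h) k ⟨
  coeff ((a ∷ f) *ₚ (g *ₚ h)) k ∎
  where open ≡-Reasoning

*ₚ-identityˡ : ∀ f → (1ₚ *ₚ f) ≈ₚ f
*ₚ-identityˡ f k = begin
  coeff (1ₚ *ₚ f) k                         ≡⟨ coeff-∷-* 1ℤ [] f k ⟩
  1ℤ ℤ.* coeff f k ℤ.+ coeff (0ℤ ∷ []) k    ≡⟨ cong₂ ℤ._+_ (ℤ.*-identityˡ (coeff f k)) (0∷[]≈[] k) ⟩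
  coeff f k ℤ.+ 0ℤ                          ≡⟨ ℤ.+-identityʳ _ ⟩
  coeff f k                                 ∎
  where open ≡-Reasoning

+ₚ-0ₚ-isCommutativeMonoid : IsCommutativeMonoid _≈ₚ_ _+ₚ_ 0ₚ
+ₚ-0ₚ-isCommutativeMonoid = record
  { isMonoid = record
    { isSemigroup = record
      { isMagma = record
        { isEquivalence = ≈ₚ-isEquivalence
        ; ∙-cong        = λ {f} {f′} {g} {g′} → +ₚ-cong {f} {f′} {g} {g′}
        }
      ; assoc = +ₚ-assoc
      }
    ; identity = (λ f k → refl) , (λ f → +ₚ-comm f 0ₚ)
    }
  ; comm = +ₚ-comm
  }

*ₚ-1ₚ-isCommutativeMonoid : IsCommutativeMonoid _≈ₚ_ _*ₚ_ 1ₚ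
*ₚ-1ₚ-isCommutativeMonoid = record
  { isMonoid = record
    { isSemigroup = record
      { isMagma = record
        { isEquivalence = ≈ₚ-isEquivalence
        ; ∙-cong        = λ {f} {f′} {g} {g′} f≈f′ g≈g′ k →
            trans (*ₚ-congʳ {f} {f′} g f≈f′ k) (*ₚ-congˡ f′ {g} {g′} g≈g′ k)
        }
      ; assoc = *ₚ-assoc
      }
    ; identity = *ₚ-identityˡ , λ f k → trans (*ₚ-comm f 1ₚ k) (*ₚ-identityˡ f k)
    }
  ; comm = *ₚ-comm
  }

-- This instance lets the generating function be computed over an arbitrary commutative semiring,
-- with the general laws of finite sums and products.
polyCommutativeSemiring : CommutativeSemiring 0ℓ 0ℓ
polyCommutativeSemiring = record
  { isCommutativeSemiring = isCommutativeSemiringˡ record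
    { +-isCommutativeMonoid = +ₚ-0ₚ-isCommutativeMonoid
    ; *-isCommutativeMonoid = *ₚ-1ₚ-isCommutativeMonoid
    ; distribʳ              = *ₚ-distribʳ
    ; zeroˡ                 = λ f k → refl
    }
  }

-- Parking outcomes

module _ {Car : Set} where

  -- A non-recursive description of where a car preferring `a` ends up; `park⁺` and `park⁻` show
  -- that `park` obeys it.
  record FirstEmptyFrom {m} (a : Fin m) (s : Street Car m) (k : Fin m) : Set where
    constructor firstEmptyFrom
    field
      after  : a Fin.≤ k
      empty  : lookup s k ≡ nothing
      filled : ∀ t → a Fin.≤ t → t Fin.< k → ∃ λ d → lookup s t ≡ just d

  FirstEmptyFrom-∷ : ∀ {m} {a : Fin m} {s : Street Car m} {k} x →
                     FirstEmptyFrom a s k → FirstEmptyFrom (suc a) (x ∷ s) (suc k)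
  FirstEmptyFrom-∷ x (firstEmptyFrom a≤k e f) = firstEmptyFrom (s≤s a≤k) e λ where
    (suc t) (s≤s a≤t) (s≤s t<k) → f t a≤t t<k

  FirstEmptyFrom-∷⁻ : ∀ {m} {a : Fin m} {s : Street Car m} {k} {x} →
                      FirstEmptyFrom (suc a) (x ∷ s) (suc k) → FirstEmptyFrom a s k
  FirstEmptyFrom-∷⁻ (firstEmptyFrom a≤k e f) =
    firstEmptyFrom (ℕ.s≤s⁻¹ a≤k) e λ t a≤t t<k → f (suc t) (s≤s a≤t) (s≤s t<k)

  FirstEmptyFrom-just∷ : ∀ {m} {s : Street Car (suc m)} {k} d →
                         FirstEmptyFrom zero s k → FirstEmptyFrom zero (just d ∷ s) (suc k)
  FirstEmptyFrom-just∷ d (firstEmptyFrom _ e f) = firstEmptyFrom z≤n e λ where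
    zero    _ _         → d , refl
    (suc t) _ (s≤s t<k) → f t z≤n t<k

  parkInFirstEmpty⁺ : ∀ {m} c (s : Street Car (suc m)) {k} → FirstEmptyFrom zero s k →
                      parkInFirstEmpty c s ≡ just (s [ k ]≔ just c)
  parkInFirstEmpty⁺ c (nothing ∷ s) {zero}  _ = refl
  parkInFirstEmpty⁺ c (nothing ∷ s) {suc k} (firstEmptyFrom _ _ f)
    with () ← proj₂ (f zero z≤n (s≤s z≤n))
  parkInFirstEmpty⁺ c (just d ∷ s@(_ ∷ _)) {suc k} (firstEmptyFrom _ e f) =
    cong (Maybe.map (just d ∷_))
      (parkInFirstEmpty⁺ c s (firstEmptyFrom z≤n e λ t _ t<k → f (suc t) z≤n (s≤s t<k)))

  parkInFirstEmpty⁻ : ∀ {m} c (s : Street Car (suc m)) {s′} → parkInFirstEmpty c s ≡ just s′ →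
                      ∃ λ k → FirstEmptyFrom zero s k × s [ k ]≔ just c ≡ s′
  parkInFirstEmpty⁻ c (nothing ∷ s) refl = zero , firstEmptyFrom z≤n refl (λ _ _ ()) , refl
  parkInFirstEmpty⁻ c (just d ∷ s@(_ ∷ _)) eq
    with s″ , eq′ , refl ← map-just⁻ (just d ∷_) (parkInFirstEmpty c s) eq
    with k , first , refl ← parkInFirstEmpty⁻ c s eq′
    = suc k , FirstEmptyFrom-just∷ d first , refl

  park⁺ : ∀ {m} a c (s : Street Car m) {k} → FirstEmptyFrom a s k →
          park a c s ≡ just (s [ k ]≔ just c)
  park⁺ zero    c s@(_ ∷ _) first = parkInFirstEmpty⁺ c s first
  park⁺ (suc a) c (x ∷ s) {zero}  (firstEmptyFrom () _ _)
  park⁺ (suc a) c (x ∷ s) {suc k} first =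
    cong (Maybe.map (x ∷_)) (park⁺ a c s (FirstEmptyFrom-∷⁻ first))

  park⁻ : ∀ {m} a c (s : Street Car m) {s′} → park a c s ≡ just s′ →
          ∃ λ k → FirstEmptyFrom a s k × s [ k ]≔ just c ≡ s′
  park⁻ zero    c s@(_ ∷ _) eq = parkInFirstEmpty⁻ c s eq
  park⁻ (suc a) c (x ∷ s)   eq
    with s″ , eq′ , refl ← map-just⁻ (x ∷_) (park a c s) eq
    with k , first , refl ← park⁻ a c s eq′
    = suc k , FirstEmptyFrom-∷ x first , refl

-- The tuples in the fiber over a permutation

module _ {n} (σ : Permutation′ n) where

  -- The street after the first m cars have parked in their spots under σ.

  record Occupied (m : ℕ) (s : Street (Fin n) n) : Set where
    constructor occupied
    field
      early : ∀ t → toℕ (σ ⟨$⟩ʳ t) ℕ.< m → lookup s t ≡ just (σ ⟨$⟩ʳ t)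
      late  : ∀ t → m ≤ toℕ (σ ⟨$⟩ʳ t) → lookup s t ≡ nothing

  open Occupied

  Occupied-replicate : Occupied 0 (replicate n nothing)
  Occupied-replicate = occupied (λ _ ()) (λ t _ → lookup-replicate t nothing)

  Occupied-just⇒< : ∀ {m s t d} → Occupied m s → lookup s t ≡ just d → toℕ (σ ⟨$⟩ʳ t) ℕ.< m
  Occupied-just⇒< {t = t} occ eq =
    ℕ.≰⇒> λ m≤ → contradiction (trans (sym (late occ t m≤)) eq) λ ()

  σ-injective : ∀ {t k} → σ ⟨$⟩ʳ t ≡ σ ⟨$⟩ʳ k → t ≡ k
  σ-injective eq = trans (sym (inverseˡ σ)) (trans (cong (σ ⟨$⟩ˡ_) eq) (inverseˡ σ))

  Occupied-suc : ∀ {m s} k → toℕ (σ ⟨$⟩ʳ k) ≡ m → Occupied m s →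
                 Occupied (suc m) (s [ k ]≔ just (σ ⟨$⟩ʳ k))
  Occupied-suc {m} {s} k refl occ = occupied early′ late′
    where
    early′ : ∀ t → toℕ (σ ⟨$⟩ʳ t) ℕ.< suc m → lookup (s [ k ]≔ _) t ≡ just (σ ⟨$⟩ʳ t)
    early′ t σt<1+m with t ≟ k
    ... | yes refl = lookup∘updateAt k s
    -- Since `σ ⟨$⟩ʳ k` equals `m`, injectivity turns the bound by `m` into a strict one.
    ... | no  t≢k  = trans (lookup∘updateAt′ t k t≢k s)
      (early occ t (≤∧≢⇒< (ℕ.s≤s⁻¹ σt<1+m) (t≢k ∘ σ-injective)))
    late′ : ∀ t → suc m ≤ toℕ (σ ⟨$⟩ʳ t) → lookup (s [ k ]≔ _) t ≡ nothing
    late′ t m<σt = trans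
      (lookup∘updateAt′ t k (λ t≡k → ℕ.<⇒≢ m<σt (cong (toℕ ∘ (σ ⟨$⟩ʳ_)) (sym t≡k))) s)
      (late occ t (ℕ.<⇒≤ m<σt))

  module _ {m : ℕ} {s : Street (Fin n) n} {a k : Fin n}
           (σk≡m : toℕ (σ ⟨$⟩ʳ k) ≡ m) (occ : Occupied m s) where

    -- Car `m` is about to arrive and belongs in spot `k`. By injectivity the other entries of the
    -- block are smaller than `m`, so their cars have parked, while spot `k` is still empty.
    IsBlock⇒FirstEmptyFrom : IsBlock σ k a → FirstEmptyFrom a s k
    IsBlock⇒FirstEmptyFrom (a≤k , block) =
      firstEmptyFrom a≤k (late occ k (ℕ.≤-reflexive (sym σk≡m))) λ t a≤t t<k →
        _ , early occ t (subst (toℕ (σ ⟨$⟩ʳ t) ℕ.<_) σk≡m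
          (≤∧≢⇒< (block t a≤t (ℕ.<⇒≤ t<k)) λ eq → ℕ.<⇒≢ t<k (cong toℕ (σ-injective eq))))

    -- A filled spot holds a car that arrived before car `m`, so its entry is below `σ ⟨$⟩ʳ k`;
    -- equality occurs at `k` itself.
    FirstEmptyFrom⇒IsBlock : FirstEmptyFrom a s k → IsBlock σ k a
    FirstEmptyFrom⇒IsBlock (firstEmptyFrom a≤k _ filled) = a≤k , block
      where
      block : ∀ t → a Fin.≤ t → t Fin.≤ k → (σ ⟨$⟩ʳ t) Fin.≤ (σ ⟨$⟩ʳ k)
      block t a≤t t≤k with t ≟ k
      ... | yes refl = ℕ.≤-refl
      ... | no  t≢k  = ℕ.≤-trans (ℕ.<⇒≤ (Occupied-just⇒< occ (proj₂ (filled t a≤t (≤∧≢⇒< t≤k t≢k)))))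
                         (ℕ.≤-reflexive (sym σk≡m))

  -- One condition per coordinate, hence a product set of tuples; `σ ⟨$⟩ˡ c` is the spot that car
  -- `c` has to reach.
  PrefersBlocks : Tuple n → Set
  PrefersBlocks α = ∀ c → IsBlock σ (σ ⟨$⟩ˡ c) (lookup α c)

  module _ (α : Tuple n) where

    -- tabulate f is the suffix of allFin n consisting of the cars m, m + 1, ….

    parkCars⁺ : ∀ {k} m (f : Fin k → Fin n) → (∀ i → toℕ (f i) ≡ m ℕ.+ toℕ i) →
                (∀ i → IsBlock σ (σ ⟨$⟩ˡ f i) (lookup α (f i))) → ∀ {s} → Occupied m s →
                ∃ λ s′ → parkCars α (tabulate f) s ≡ just s′ × Occupied (m ℕ.+ k) s′
    parkCars⁺ {zero}  m f f≡ blocks {s} occ =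
      s , refl , subst (λ j → Occupied j s) (sym (ℕ.+-identityʳ m)) occ
    parkCars⁺ {suc k} m f f≡ blocks {s} occ =
      let s′ , eq , occ′ = parkCars⁺ (suc m) (f ∘ suc)
                             (λ i → trans (f≡ (suc i)) (ℕ.+-suc m (toℕ i)))
                             (blocks ∘ suc) (Occupied-suc spot σspot≡m occ)
      in  s′
        , trans (cong (_>>= parkCars α (tabulate (f ∘ suc))) parks) eq
        , subst (λ j → Occupied j s′) (sym (ℕ.+-suc m k)) occ′
      where
      spot = σ ⟨$⟩ˡ f zero
      σspot≡m : toℕ (σ ⟨$⟩ʳ spot) ≡ m
      σspot≡m = trans (cong toℕ (inverseʳ σ)) (trans (f≡ zero) (ℕ.+-identityʳ m))
      parks : park (lookup α (f zero)) (f zero) s ≡ just (s [ spot ]≔ just (σ ⟨$⟩ʳ spot))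
      parks = trans
        (park⁺ (lookup α (f zero)) (f zero) s (IsBlock⇒FirstEmptyFrom σspot≡m occ (blocks zero)))
        -- `park⁺` writes the parked car as `f zero`, `Occupied-suc` as `σ ⟨$⟩ʳ spot`.
        (cong (λ c → just (s [ spot ]≔ just c)) (sym (inverseʳ σ)))

    -- The spot taken by the next car is not known beforehand. Parked cars never move, so the final
    -- street forces it to be the spot of that car under `σ`.
    parkCars⁻ : ∀ {k} m (f : Fin k → Fin n) → (∀ i → toℕ (f i) ≡ m ℕ.+ toℕ i) →
                ∀ {s s′} → Occupied m s → parkCars α (tabulate f) s ≡ just s′ →
                (∀ t → lookup s′ t ≡ just (σ ⟨$⟩ʳ t)) →
                ∀ i → IsBlock σ (σ ⟨$⟩ˡ f i) (lookup α (f i))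
    parkCars⁻ {suc k} m f f≡ {s} occ eq final i
      with s₁ , eq₁ , eq₂ ← >>=-just⁻ (park (lookup α (f zero)) (f zero) s) _ eq
      with spot , first , refl ← park⁻ (lookup α (f zero)) (f zero) s eq₁
      = blocks i
      where
      σspot≡f₀ : σ ⟨$⟩ʳ spot ≡ f zero
      σspot≡f₀ = just-injective (trans (sym (final spot))
        (parkCars-keeps α (tabulate (f ∘ suc)) _ eq₂ spot (lookup∘updateAt spot s)))
      σspot≡m : toℕ (σ ⟨$⟩ʳ spot) ≡ m
      σspot≡m = trans (cong toℕ σspot≡f₀) (trans (f≡ zero) (ℕ.+-identityʳ m))
      blocks : ∀ i → IsBlock σ (σ ⟨$⟩ˡ f i) (lookup α (f i))
      blocks zero    = subst (λ k → IsBlock σ k (lookup α (f zero)))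
        (trans (sym (inverseˡ σ)) (cong (σ ⟨$⟩ˡ_) σspot≡f₀))
        (FirstEmptyFrom⇒IsBlock σspot≡m occ first)
      blocks (suc i) = parkCars⁻ (suc m) (f ∘ suc)
        (λ i → trans (f≡ (suc i)) (ℕ.+-suc m (toℕ i)))
        (subst (λ c → Occupied (suc m) (s [ spot ]≔ just c)) σspot≡f₀
          (Occupied-suc spot σspot≡m occ))
        eq₂ final i

    PrefersBlocks⇒outcome : PrefersBlocks α →
      ∃ λ s → outcome α ≡ just s × (∀ t → lookup s t ≡ just (σ ⟨$⟩ʳ t))
    PrefersBlocks⇒outcome blocks =
      let s , eq , occ = parkCars⁺ 0 (λ i → i) (λ _ → refl) blocks Occupied-replicate
      -- After all `n` cars every spot counts as early, because entries are below `n`.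
      in  s , eq , λ t → early occ t (toℕ<n (σ ⟨$⟩ʳ t))

    PrefersBlocks⇒IsParkingFunction : PrefersBlocks α → IsParkingFunction α
    PrefersBlocks⇒IsParkingFunction blocks with PrefersBlocks⇒outcome blocks
    ... | s , eq , _ = subst Is-just (sym eq) (MaybeAny.just tt)

  -- `φ` is built from a search for the car in each spot, so the comparison goes through the final
  -- street, where both permutations can be read off.
  PrefersBlocks⇒φ≈ : ∀ p → PrefersBlocks (proj₁ p) → φ p Perm.≈ σ
  PrefersBlocks⇒φ≈ p@(α , parks) blocks i with PrefersBlocks⇒outcome α blocks
  ... | s , eq , final = just-injective (trans (sym (finalStreet-φ p i))
    (trans (cong (λ s → lookup s i) (just-injective (trans (sym (to-witness-just parks)) eq)))
      (final i)))

  φ≈⇒PrefersBlocks : ∀ p → φ p Perm.≈ σ → PrefersBlocks (proj₁ p)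
  φ≈⇒PrefersBlocks p@(α , parks) φp≈σ =
    parkCars⁻ α 0 (λ i → i) (λ _ → refl) Occupied-replicate (to-witness-just parks)
      λ t → trans (finalStreet-φ p t) (cong just (φp≈σ t))

-- The generating function of a fiber

module ℕΣ = MonoidSum ℕ.+-0-commutativeMonoid
module ℤΣ = MonoidSum ℤ.+-0-commutativeMonoid

-- The length of a block ending at `i` decreases strictly in its start, so a longest block has the
-- least start. Summing the weights requires this start rather than the length.
ℓ-attained : ∀ {n} (i : Fin n) (σ : Permutation′ n) → ∃ λ j →
  ℓ i σ ≡ suc (toℕ i) ∸ toℕ j × IsBlock σ i j × (∀ a → IsBlock σ i a → j Fin.≤ a)
ℓ-attained {n} i σ = attained (argmax-sel id 0 lengths)
  where
  length : Fin n → ℕ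
  length j = suc (toℕ i) ∸ toℕ j

  lengths : List ℕ
  lengths = map length (filter (isBlock? σ i) (allFin n))

  length≤ℓ : ∀ a → IsBlock σ i a → length a ≤ ℓ i σ
  length≤ℓ a block = All.lookup (xs≤max 0 lengths)
    (∈-map⁺ length (∈-filter⁺ (isBlock? σ i) (∈-allFin a) block))

  block-i : IsBlock σ i i
  block-i = ℕ.≤-refl , λ t i≤t t≤i → ℕ.≤-reflexive (cong (toℕ ∘ (σ ⟨$⟩ʳ_)) (≤-antisym t≤i i≤t))

  attained : _ → _
  -- The default value 0 of `max` is excluded by the one-entry block at `i`, whose length is
  -- positive.
  attained (inj₁ ℓ≡0) = contradiction
    (ℕ.≤-trans (ℕ.m<n⇒0<n∸m (ℕ.n<1+n (toℕ i))) (length≤ℓ i block-i)) (ℕ.<-irrefl (sym ℓ≡0))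
  attained (inj₂ ℓ∈) with ∈-map⁻ length ℓ∈
  ... | j , j∈ , ℓ≡ =
    let block = proj₂ (∈-filter⁻ (isBlock? σ i) {xs = allFin n} j∈)
    in  j , ℓ≡ , block , λ a block-a → ℕ.≮⇒≥ λ a<j →
          -- An earlier start would exceed the maximum; `j ≤ suc i` ensures that truncated
          -- subtraction is strictly decreasing here.
          ℕ.<⇒≱ (ℕ.∸-monoʳ-< a<j (ℕ.m≤n⇒m≤1+n (proj₁ block)))
            (subst (length a ≤_) ℓ≡ (length≤ℓ a block-a))

+-sum : ∀ {n} (f : Fin n → ℕ) → ℤΣ.sum (+_ ∘ f) ≡ + ℕΣ.sum f
+-sum {zero}  f = refl
+-sum {suc n} f = cong (ℤ._+_ (+ f zero)) (+-sum (f ∘ suc))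

-- No car parks before its preferred spot, so truncated subtraction agrees with integer subtraction
-- in every term. Natural exponents are what powers of `q` need.
area-displacement : ∀ {n} (p : PF n) →
  area p ≡ ℕΣ.sum (λ c → toℕ (spotOf p c) ∸ toℕ (lookup (proj₁ p) c))
area-displacement {n} p@(α , _) = ℤ.+-injective (begin
  + area p
    ≡⟨ area-areaℤ p ⟩
  areaℤ α
    ≡⟨ areaℤ-displacement p ⟩
  ℤΣ.sum (λ c → + toℕ (spotOf p c) ℤ.- + toℕ (lookup α c))
    ≡⟨ ℤΣ.sum-cong-≗ {n} (λ c → trans (ℤ.m-n≡m⊖n (toℕ (spotOf p c)) (toℕ (lookup α c)))
                                      (ℤ.⊖-≥ (preference≤spotOf p c))) ⟩
  ℤΣ.sum (λ c → + (toℕ (spotOf p c) ∸ toℕ (lookup α c)))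
    ≡⟨ +-sum (λ c → toℕ (spotOf p c) ∸ toℕ (lookup α c)) ⟩
  + ℕΣ.sum (λ c → toℕ (spotOf p c) ∸ toℕ (lookup α c)) ∎)
  where open ≡-Reasoning

-- `Perm.≈` compares the forward maps only; agreement of the inverses, which send cars to spots, has
-- to be derived.
spotOf-φ≈ : ∀ {n} (σ : Permutation′ n) p → φ p Perm.≈ σ → ∀ c → spotOf p c ≡ σ ⟨$⟩ˡ c
spotOf-φ≈ σ p φp≈σ c = begin
  spotOf p c                      ≡⟨ cong (spotOf p) (inverseʳ σ) ⟨
  spotOf p (σ ⟨$⟩ʳ (σ ⟨$⟩ˡ c))    ≡⟨ cong (spotOf p) (φp≈σ (σ ⟨$⟩ˡ c)) ⟨
  spotOf p (carIn p (σ ⟨$⟩ˡ c))   ≡⟨ spotOf-carIn p (σ ⟨$⟩ˡ c) ⟩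
  σ ⟨$⟩ˡ c                        ∎
  where open ≡-Reasoning

-- Connects the list folds of the statement with the `Fin`-indexed sums, for which reindexing by a
-- permutation is available.
foldr-allFin : ∀ {c e} (M : CommutativeMonoid c e) → let open CommutativeMonoid M in
               ∀ {n} (f : Fin n → Carrier) → foldr _∙_ ε (map f (allFin n)) ≡ MonoidSum.sum M f
foldr-allFin M f = trans (cong (foldr _∙_ ε) (map-tabulate id f)) (foldr-tabulate f)
  where
  open CommutativeMonoid M using (Carrier; _∙_; ε)
  foldr-tabulate : ∀ {n} (f : Fin n → Carrier) → foldr _∙_ ε (tabulate f) ≡ MonoidSum.sum M f
  foldr-tabulate {zero}  f = refl
  foldr-tabulate {suc n} f = cong (f zero ∙_) (foldr-tabulate (f ∘ suc))

-- Finite sums and products in a commutative semiring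

module _ {c e} (R : CommutativeSemiring c e) where

  open CommutativeSemiring R hiding (zero) renaming (refl to ≈-refl; sym to ≈-sym; trans to ≈-trans)
  open import Relation.Binary.Reasoning.Setoid setoid
  module Σ = SemiringSum semiring
  module Π = MonoidSum *-commutativeMonoid

  ∑ ∏ : ∀ {a} {A : Set a} → List A → (A → Carrier) → Carrier
  ∑ xs f = foldr _+_ 0# (map f xs)
  ∏ xs f = foldr _*_ 1# (map f xs)

  -- Gives each branch the proof or refutation that the Boolean `does P?` forgets.
  if-does : ∀ {p} {P : Set p} (P? : Dec P) {x y z} →
            (P → x ≈ z) → (¬ P → y ≈ z) → (if does P? then x else y) ≈ z
  if-does (yes p) x≈z y≈z = x≈z p
  if-does (no ¬p) x≈z y≈z = y≈z ¬p

  module _ {a} {A : Set a} where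

    ∑-cong : ∀ (xs : List A) {f g} → (∀ x → f x ≈ g x) → ∑ xs f ≈ ∑ xs g
    ∑-cong []       f≈g = ≈-refl
    ∑-cong (x ∷ xs) f≈g = +-cong (f≈g x) (∑-cong xs f≈g)

    ∑-++ : ∀ (xs ys : List A) f → ∑ (xs ++ ys) f ≈ ∑ xs f + ∑ ys f
    ∑-++ []       ys f = ≈-sym (+-identityˡ _)
    ∑-++ (x ∷ xs) ys f = ≈-trans (+-congˡ (∑-++ xs ys f)) (≈-sym (+-assoc _ _ _))

    *-distribˡ-∑ : ∀ y (xs : List A) f → y * ∑ xs f ≈ ∑ xs (λ x → y * f x)
    *-distribˡ-∑ y []       f = zeroʳ y
    *-distribˡ-∑ y (x ∷ xs) f = ≈-trans (distribˡ y _ _) (+-congˡ (*-distribˡ-∑ y xs f))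

    *-distribʳ-∑ : ∀ y (xs : List A) f → ∑ xs f * y ≈ ∑ xs (λ x → f x * y)
    *-distribʳ-∑ y []       f = zeroˡ y
    *-distribʳ-∑ y (x ∷ xs) f = ≈-trans (distribʳ y _ _) (+-congˡ (*-distribʳ-∑ y xs f))

    ∑-filter : ∀ {p} {P : A → Set p} (P? : Decidable P) xs f →
               ∑ (filter P? xs) f ≈ ∑ xs (λ x → if does (P? x) then f x else 0#)
    ∑-filter P? []       f = ≈-refl
    ∑-filter P? (x ∷ xs) f with does (P? x)
    ... | true  = +-congˡ (∑-filter P? xs f)
    ... | false = ≈-trans (∑-filter P? xs f) (≈-sym (+-identityˡ _))

    ∑-map : ∀ {b} {B : Set b} (g : B → A) xs f → ∑ (map g xs) f ≈ ∑ xs (f ∘ g)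
    ∑-map g []       f = ≈-refl
    ∑-map g (x ∷ xs) f = +-congˡ (∑-map g xs f)

    ∑-mapMaybe : ∀ {b} {B : Set b} (g : B → Maybe A) xs f →
                 ∑ (mapMaybe g xs) f ≈ ∑ xs (λ x → maybe′ f 0# (g x))
    ∑-mapMaybe g []       f = ≈-refl
    ∑-mapMaybe g (x ∷ xs) f with g x
    ... | just y  = +-congˡ (∑-mapMaybe g xs f)
    ... | nothing = ≈-trans (∑-mapMaybe g xs f) (≈-sym (+-identityˡ _))

    ∑-cartesianProductWith : ∀ {b d} {B : Set b} {D : Set d} (g : B → D → A) xs ys f →
      ∑ (cartesianProductWith g xs ys) f ≈ ∑ xs (λ x → ∑ ys (λ y → f (g x y)))
    ∑-cartesianProductWith g []       ys f = ≈-refl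
    ∑-cartesianProductWith g (x ∷ xs) ys f = ≈-trans
      (∑-++ (map (g x) ys) (cartesianProductWith g xs ys) f)
      (+-cong (∑-map (g x) ys f) (∑-cartesianProductWith g xs ys f))

  -- The first spot of an interval carries the largest exponent, so `Σ-interval` needs the last
  -- index split off in front.
  ∑-upTo-suc : ∀ m f → ∑ (upTo (suc m)) f ≈ f m + ∑ (upTo m) f
  ∑-upTo-suc m f = begin
    ∑ (upTo (suc m)) f          ≡⟨ cong (λ xs → ∑ xs f) (upTo-∷ʳ m) ⟨
    ∑ (upTo m ++ m ∷ []) f      ≈⟨ ∑-++ (upTo m) (m ∷ []) f ⟩
    ∑ (upTo m) f + (f m + 0#)   ≈⟨ +-congˡ (+-identityʳ (f m)) ⟩
    ∑ (upTo m) f + f m          ≈⟨ +-comm _ _ ⟩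
    f m + ∑ (upTo m) f          ∎

  -- Expanding a product of sums chooses one term from each factor, and `vectors` lists the choices.
  -- The induction factors out the first coordinate by distributivity.
  ∑-vectors : ∀ {n} k (w : Fin k → Fin n → Carrier) →
    ∑ (vectors n k) (λ v → Π.sum (λ c → w c (lookup v c))) ≈ Π.sum (λ c → Σ.sum (w c))
  ∑-vectors {n} zero    w = +-identityʳ 1#
  ∑-vectors {n} (suc k) w = begin
    ∑ (vectors n (suc k)) (λ v → Π.sum (λ c → w c (lookup v c)))
      ≈⟨ ∑-cartesianProductWith _∷_ (allFin n) (vectors n k) _ ⟩
    ∑ (allFin n) (λ a → ∑ (vectors n k) (λ v → w zero a * rest v))
      ≈⟨ ∑-cong (allFin n) (λ a → ≈-sym (*-distribˡ-∑ (w zero a) (vectors n k) rest)) ⟩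
    ∑ (allFin n) (λ a → w zero a * ∑ (vectors n k) rest)
      ≈⟨ *-distribʳ-∑ (∑ (vectors n k) rest) (allFin n) (w zero) ⟨
    ∑ (allFin n) (w zero) * ∑ (vectors n k) rest
      ≈⟨ *-cong (reflexive (foldr-allFin +-commutativeMonoid (w zero))) (∑-vectors k (w ∘ suc)) ⟩
    Σ.sum (w zero) * Π.sum (λ c → Σ.sum (w (suc c))) ∎
    where
    rest : _ → Carrier
    rest v = Π.sum (λ c → w (suc c) (lookup v c))

  Σ-zero : ∀ {n} (f : Fin n → Carrier) → (∀ a → f a ≈ 0#) → Σ.sum f ≈ 0#
  Σ-zero {n} f f≈0 = ≈-trans (Σ.sum-cong-≋ f≈0) (Σ.sum-replicate-zero n)

  Π-zero : ∀ {n} (f : Fin n → Carrier) i → f i ≈ 0# → Π.sum f ≈ 0#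
  Π-zero f zero    fi≈0 = ≈-trans (*-congʳ fi≈0) (zeroˡ _)
  Π-zero f (suc i) fi≈0 = ≈-trans (*-congˡ (Π-zero (f ∘ suc) i fi≈0)) (zeroʳ _)

  -- As `a` runs from `j` to `i`, the exponent `i - a` takes each value from `i - j` down to 0 once.
  -- The induction first discards the zero terms before `j`, then collects the interval, and stops
  -- at `i`.
  Σ-interval : ∀ {n} (f : Fin n → Carrier) (h : ℕ → Carrier) j (i : Fin n) → j ≤ toℕ i →
    (∀ a → j ≤ toℕ a → a Fin.≤ i → f a ≈ h (toℕ i ∸ toℕ a)) →
    (∀ a → ¬ (j ≤ toℕ a × a Fin.≤ i) → f a ≈ 0#) →
    Σ.sum f ≈ ∑ (upTo (suc (toℕ i) ∸ j)) h
  Σ-interval f h zero zero _ inside outside =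
    +-cong (inside zero z≤n z≤n) (Σ-zero (f ∘ suc) λ a → outside (suc a) λ { (_ , ()) })
  Σ-interval f h zero (suc i) _ inside outside = begin
    f zero + Σ.sum (f ∘ suc)
      ≈⟨ +-cong (inside zero z≤n z≤n)
           (Σ-interval (f ∘ suc) h zero i z≤n
             (λ a _ a≤i → inside (suc a) z≤n (s≤s a≤i))
             (λ a a∉ → outside (suc a) λ { (_ , s≤s a≤i) → a∉ (z≤n , a≤i) })) ⟩
    h (suc (toℕ i)) + ∑ (upTo (suc (toℕ i))) h
      ≈⟨ ∑-upTo-suc (suc (toℕ i)) h ⟨
    ∑ (upTo (suc (suc (toℕ i)))) h ∎
  Σ-interval f h (suc j) (suc i) (s≤s j≤i) inside outside = begin
    f zero + Σ.sum (f ∘ suc)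
      ≈⟨ +-cong (outside zero λ { (() , _) })
           (Σ-interval (f ∘ suc) h j i j≤i
             (λ a j≤a a≤i → inside (suc a) (s≤s j≤a) (s≤s a≤i))
             (λ a a∉ → outside (suc a) λ { (s≤s j≤a , s≤s a≤i) → a∉ (j≤a , a≤i) })) ⟩
    0# + ∑ (upTo (suc (toℕ i) ∸ j)) h
      ≈⟨ +-identityˡ _ ⟩
    ∑ (upTo (suc (toℕ i) ∸ j)) h ∎

  module _ (pow : ℕ → Carrier) (pow-0 : pow 0 ≈ 1#)
           (pow-+ : ∀ k l → pow (k ℕ.+ l) ≈ pow k * pow l) where

    Π-pow : ∀ {n} (d : Fin n → ℕ) → Π.sum (pow ∘ d) ≈ pow (ℕΣ.sum d)
    Π-pow {zero}  d = ≈-sym pow-0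
    Π-pow {suc n} d = ≈-trans (*-congˡ (Π-pow (d ∘ suc))) (≈-sym (pow-+ (d zero) _))

    -- Weights of preferences and the sum over the fiber

    module _ {n} (σ : Permutation′ n) where

      -- The value 0 on inadmissible preferences encodes membership in the fiber, so that the sum
      -- can range over all tuples.
      blockWeight : Fin n → Fin n → Carrier
      blockWeight i a = if does (isBlock? σ i a) then pow (toℕ i ∸ toℕ a) else 0#

      blockWeight-IsBlock : ∀ {i a} → IsBlock σ i a → blockWeight i a ≈ pow (toℕ i ∸ toℕ a)
      blockWeight-IsBlock {i} {a} block =
        if-does (isBlock? σ i a) (λ _ → ≈-refl) (contradiction block)

      blockWeight-¬IsBlock : ∀ {i a} → ¬ IsBlock σ i a → blockWeight i a ≈ 0#
      blockWeight-¬IsBlock {i} {a} ¬block =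
        if-does (isBlock? σ i a) (λ block → contradiction block ¬block) (λ _ → ≈-refl)

      -- Shortening a block from the left leaves a block, so the admissible preferences form the
      -- whole interval from the least start `j` to `i`.
      Σ-blockWeight : ∀ i → Σ.sum (blockWeight i) ≈ ∑ (upTo (ℓ i σ)) pow
      Σ-blockWeight i with ℓ-attained i σ
      ... | j , ℓ≡ , (j≤i , block) , j-least = ≈-trans
        (Σ-interval (blockWeight i) pow (toℕ j) i j≤i
          (λ a j≤a a≤i → blockWeight-IsBlock (a≤i , λ t a≤t → block t (ℕ.≤-trans j≤a a≤t)))
          (λ a a∉ → blockWeight-¬IsBlock λ block-a → a∉ (j-least a block-a , proj₁ block-a)))
        (reflexive (cong (λ m → ∑ (upTo m) pow) (sym ℓ≡)))

      preferenceWeight : Tuple n → Carrier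
      preferenceWeight α = Π.sum (λ c → blockWeight (σ ⟨$⟩ˡ c) (lookup α c))

      -- On the fiber the area is the total displacement from spots fixed by `σ`, and every factor
      -- of the weight is a power, since every preference starts a block.
      preferenceWeight-φ≈ : ∀ p → φ p Perm.≈ σ → pow (area p) ≈ preferenceWeight (proj₁ p)
      preferenceWeight-φ≈ p@(α , _) φp≈σ = begin
        pow (area p)
          ≡⟨ cong pow (area-displacement p) ⟩
        pow (ℕΣ.sum (λ c → toℕ (spotOf p c) ∸ toℕ (lookup α c)))
          ≈⟨ Π-pow (λ c → toℕ (spotOf p c) ∸ toℕ (lookup α c)) ⟨
        Π.sum (λ c → pow (toℕ (spotOf p c) ∸ toℕ (lookup α c)))
          ≡⟨ Π.sum-cong-≗ {n} (λ c →
               cong (λ k → pow (toℕ k ∸ toℕ (lookup α c))) (spotOf-φ≈ σ p φp≈σ c)) ⟩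
        Π.sum (λ c → pow (toℕ (σ ⟨$⟩ˡ c) ∸ toℕ (lookup α c)))
          ≈⟨ Π.sum-cong-≋ (λ c → blockWeight-IsBlock (φ≈⇒PrefersBlocks σ p φp≈σ c)) ⟨
        preferenceWeight α ∎

      preferenceWeight-¬PrefersBlocks : ∀ α → ¬ PrefersBlocks σ α → preferenceWeight α ≈ 0#
      preferenceWeight-¬PrefersBlocks α ¬blocks =
        -- Decidability over finitely many cars yields a specific violating car, whose zero factor
        -- kills the product.
        let c , ¬block = ¬∀⟶∃¬ n _ (λ c → isBlock? σ (σ ⟨$⟩ˡ c) (lookup α c)) ¬blocks
        in  Π-zero _ c (blockWeight-¬IsBlock ¬block)

      fiberWeight : PF n → Carrier
      fiberWeight p = if does (φ p ≈? σ) then pow (area p) else 0#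

      -- Off the fiber, whether some car fails to park or the outcome differs from `σ`, some
      -- preference violates its block condition and both sides vanish.
      fiberWeight≈preferenceWeight : ∀ α →
        maybe′ fiberWeight 0# (Maybe.map (α ,_) (dec⇒maybe (isParkingFunction? α))) ≈ preferenceWeight α
      fiberWeight≈preferenceWeight α with isParkingFunction? α
      ... | no ¬parks = ≈-sym (preferenceWeight-¬PrefersBlocks α
                               (¬parks ∘ PrefersBlocks⇒IsParkingFunction σ α))
      ... | yes parks = if-does (φ (α , parks) ≈? σ)
        (preferenceWeight-φ≈ (α , parks))
        (λ φp≉σ → ≈-sym (preferenceWeight-¬PrefersBlocks α (φp≉σ ∘ PrefersBlocks⇒φ≈ σ (α , parks))))

      ∑-fiber : ∑ (fiber σ) (pow ∘ area) ≈ ∏ (allFin n) (λ i → ∑ (upTo (ℓ i σ)) pow)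
      ∑-fiber = begin
        ∑ (fiber σ) (pow ∘ area)
          ≈⟨ ∑-filter (λ p → φ p ≈? σ) (parkingFunctions n) (pow ∘ area) ⟩
        ∑ (parkingFunctions n) fiberWeight
          ≈⟨ ∑-mapMaybe _ (vectors n n) fiberWeight ⟩
        ∑ (vectors n n) (λ α → maybe′ fiberWeight 0# (Maybe.map (α ,_) (dec⇒maybe (isParkingFunction? α))))
          ≈⟨ ∑-cong (vectors n n) fiberWeight≈preferenceWeight ⟩
        ∑ (vectors n n) preferenceWeight
          ≈⟨ ∑-vectors n (λ c → blockWeight (σ ⟨$⟩ˡ c)) ⟩
        Π.sum (λ c → Σ.sum (blockWeight (σ ⟨$⟩ˡ c)))
          -- Reindexing by `σ` turns the product over cars into one over spots.
          ≈⟨ Π.sum-permute (λ i → Σ.sum (blockWeight i)) (flip σ) ⟨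
        Π.sum (λ i → Σ.sum (blockWeight i))
          ≈⟨ Π.sum-cong-≋ Σ-blockWeight ⟩
        Π.sum (λ i → ∑ (upTo (ℓ i σ)) pow)
          ≡⟨ foldr-allFin *-commutativeMonoid (λ i → ∑ (upTo (ℓ i σ)) pow) ⟨
        ∏ (allFin n) (λ i → ∑ (upTo (ℓ i σ)) pow) ∎

q-^ₚ-+ : ∀ k l → q ^ₚ (k ℕ.+ l) ≈ₚ (q ^ₚ k *ₚ q ^ₚ l)
q-^ₚ-+ zero    l j = sym (*ₚ-identityˡ (q ^ₚ l) j)
q-^ₚ-+ (suc k) l j =
  trans (*ₚ-congˡ q {q ^ₚ (k ℕ.+ l)} {q ^ₚ k *ₚ q ^ₚ l} (q-^ₚ-+ k l) j)
        (sym (*ₚ-assoc q (q ^ₚ k) (q ^ₚ l) j))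

proposition5p2 : (n : ℕ) → 1 ≤ n → (σ : Permutation′ n) →
    sumₚ (map (λ p → q ^ₚ area p) (fiber σ)) ≈ₚ productₚ (map (λ i → [ ℓ i σ ]q) (allFin n))
-- `sumₚ`, `productₚ` and `[_]q` unfold to the folds `∑` and `∏` taken in the polynomial semiring.
proposition5p2 n _ σ = ∑-fiber polyCommutativeSemiring (q ^ₚ_) (λ _ → refl) q-^ₚ-+ σ
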